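{- Let $k\ge 1$ be a fixed integer. There is an algorithm that, given any tree $T$ with $n$ vertices, computes $\gamma_{1k}(T)$ in time linear in $n$, i.e. in $O(n)$ time.
   Context: A tree is a finite connected acyclic simple graph. A $k$-quasiperfect dominating set of a graph $G$ is a set $S$ of vertices such that every vertex not in $S$ is adjacent to at least one and at most $k$ vertices of $S$; $\gamma_{1k}(G)$ is the minimum cardinality of such a set. The tree is given as a rooted tree with vertices numbered $1,\dots,n$, root $1$, every non-root vertex having a number greater than that of its parent, stored as an array $\mathrm{Parent}[1\ldots n]$ in which each non-root vertex $i$ points to its parent. Running time counts elementary operations (array access, comparison and addition of integers bounded by $n$ or of the symbol $\infty$), each of unit cost. -}

module Defs where

open import Data.Bool.Base using (Bool; true; false)
open import Data.Fin.Base using (Fin; zero; suc; toℕ)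
open import Data.Fin.Subset using (Subset; _∉_; _∩_; ∣_∣)
open import Data.List.Base using (List; _∷_; _∷ʳ_; length)
open import Data.List.Relation.Unary.Linked using (Linked)
open import Data.List.Relation.Unary.Unique.Propositional using (Unique)
open import Data.Maybe.Relation.Unary.All using (All)
open import Data.Nat.Base using (ℕ; suc; _+_; _≤_; _<_; NonZero)
open import Data.Product.Base using (_×_; ∃-syntax)
open import Data.Sum.Base using (_⊎_)
open import Data.Vec.Base using (tabulate)
open import Data.Vec.Functional using (Vector; updateAt)
open import Function.Base using (const)
open import Function.Bundles using (_⇔_)
open import Level using (0ℓ)
open import Relation.Binary.Core using (Rel)
open import Relation.Binary.Construct.Add.Supremum.NonStrict _≤_ using (_≤⁺_)
open import Relation.Binary.Construct.Add.Supremum.Strict _<_ using (_<⁺_)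
open import Relation.Binary.Construct.Closure.ReflexiveTransitive using (Star)
open import Relation.Binary.Definitions using (Decidable; Irreflexive; Symmetric)
open import Relation.Binary.PropositionalEquality.Core using (_≡_; _≢_)
open import Relation.Nullary.Construct.Add.Supremum using (_⁺; [_]; ⊤⁺)
open import Relation.Nullary.Decidable.Core using (does)
open import Relation.Nullary.Negation.Core using (¬_)
open import Relation.Nullary.Reflects using (Reflects)

------------------------------------------------------------------------
-- Graphs and trees

record Graph (n : ℕ) : Set₁ where
  field
    Adj   : Rel (Fin n) 0ℓ
    adj?  : Decidable Adj
    sym   : Symmetric Adj
    irrefl : Irreflexive _≡_ Adj

  neighbours : Fin n → Subset n
  neighbours v = tabulate (λ u → does (adj? v u))

  Connected : Set
  Connected = ∀ u v → Star Adj u v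

  -- A cycle is a closed walk u , ys , u on at least three vertices u ∷ ys,
  -- all distinct.
  Acyclic : Set
  Acyclic = ∀ u ys → 2 ≤ length ys → Unique (u ∷ ys) →
            ¬ Linked Adj (u ∷ ys ∷ʳ u)

record IsTree {n : ℕ} (G : Graph n) : Set where
  open Graph G
  field
    nonEmpty  : NonZero n
    connected : Connected
    acyclic   : Acyclic

------------------------------------------------------------------------
-- Quasiperfect domination

module _ {n : ℕ} (k : ℕ) (G : Graph n) where
  open Graph G

  QuasiperfectDominating : Subset n → Set
  QuasiperfectDominating S = ∀ v → v ∉ S →
    1 ≤ ∣ S ∩ neighbours v ∣ × ∣ S ∩ neighbours v ∣ ≤ k

  Isγ₁ₖ : ℕ → Set
  Isγ₁ₖ m = (∃[ S ] QuasiperfectDominating S × ∣ S ∣ ≡ m)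
          × (∀ S → QuasiperfectDominating S → m ≤ ∣ S ∣)

------------------------------------------------------------------------
-- Rooted trees as parent arrays

-- Vertices are numbered 1 … n; the root is the vertex numbered 1.
# : ∀ {n} → Fin n → ℕ
# v = suc (toℕ v)

-- The entry of the root is left unconstrained.
record IsParentArray {n : ℕ} (G : Graph n) (Parent : Vector ℕ n) : Set where
  open Graph G

  _ParentOf_ : Rel (Fin n) 0ℓ
  p ParentOf v = # v ≢ 1 × Parent v ≡ # p

  field
    hasParent  : ∀ v → # v ≢ 1 → ∃[ p ] p ParentOf v
    increasing : ∀ p v → p ParentOf v → # p < # v
    edges      : ∀ u v → Adj u v ⇔ (u ParentOf v ⊎ v ParentOf u)

------------------------------------------------------------------------
-- Algorithms: programs in a structured language over finitely many scalar variables
-- and finitely many arrays of length n.  Nothing in a program depends on n.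

ℕ∞ : Set
ℕ∞ = ℕ ⁺

_+∞_ : ℕ∞ → ℕ∞ → ℕ∞
[ x ] +∞ [ y ] = [ x + y ]
[ x ] +∞ ⊤⁺    = ⊤⁺
⊤⁺    +∞ y     = ⊤⁺

data Comparison : Set where
  le lt eq : Comparison

⟦_⟧ : Comparison → Rel ℕ∞ 0ℓ
⟦ le ⟧ = _≤⁺_
⟦ lt ⟧ = _<⁺_
⟦ eq ⟧ = _≡_

module Syntax (s a : ℕ) where

  infixr 7 _!_
  infixl 6 _⊕_
  infix  5 _⟨_⟩_
  infix  4 _≔_ _[_]≔_
  infixr 3 _⨾_

  data Expr : Set where
    lit  : ℕ∞ → Expr
    var  : Fin s → Expr
    _!_  : Fin a → Expr → Expr
    _⊕_  : Expr → Expr → Expr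

  data Test : Set where
    _⟨_⟩_ : Expr → Comparison → Expr → Test

  data Cmd : Set where
    skip   : Cmd
    _≔_    : Fin s → Expr → Cmd
    _[_]≔_ : Fin a → Expr → Expr → Cmd
    _⨾_    : Cmd → Cmd → Cmd
    if_then_else_ : Test → Cmd → Cmd → Cmd
    while_loop_   : Test → Cmd → Cmd

  -- Evaluating any node of an expression or test takes one unit of time.
  exprCost : Expr → ℕ
  exprCost (lit _)   = 1
  exprCost (var _)   = 1
  exprCost (_ ! e)   = 1 + exprCost e
  exprCost (e ⊕ e′)  = 1 + exprCost e + exprCost e′

  testCost : Test → ℕ
  testCost (e ⟨ _ ⟩ e′) = 1 + exprCost e + exprCost e′

module Semantics (s a n : ℕ) where
  open Syntax s a public

  record Store : Set where
    constructor store
    field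
      scalar : Vector ℕ∞ s
      array  : Vector (Vector ℕ∞ n) a

  open Store public

  setScalar : Fin s → ℕ∞ → Store → Store
  setScalar x v σ = store (updateAt (scalar σ) x (const v)) (array σ)

  setCell : Fin a → Fin n → ℕ∞ → Store → Store
  setCell b i v σ =
    store (scalar σ) (updateAt (array σ) b (λ xs → updateAt xs i (const v)))

  -- Additions and comparisons are defined only on operands that are ∞ or at
  -- most n, so that no unit-cost operation acts on large integers.
  Operand : ℕ∞ → Set
  Operand = All (_≤ n)

  infix 2 _⊢_⇓_ _⊢_⇓ᵗ_ ⟨_,_⟩⇓⟨_⟩_

  -- Arrays are indexed 1 … n; there is no rule for an access out of bounds.
  data _⊢_⇓_ (σ : Store) : Expr → ℕ∞ → Set where
    lit : ∀ {v} → σ ⊢ lit v ⇓ v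
    var : ∀ {x} → σ ⊢ var x ⇓ scalar σ x
    _!_ : ∀ b {e i} → σ ⊢ e ⇓ [ # i ] → σ ⊢ b ! e ⇓ array σ b i
    add : ∀ {e e′ v v′} → σ ⊢ e ⇓ v → σ ⊢ e′ ⇓ v′ →
          Operand v → Operand v′ → σ ⊢ e ⊕ e′ ⇓ v +∞ v′

  data _⊢_⇓ᵗ_ (σ : Store) : Test → Bool → Set where
    compare : ∀ {r e e′ v v′ b} → σ ⊢ e ⇓ v → σ ⊢ e′ ⇓ v′ →
              Operand v → Operand v′ → Reflects (⟦ r ⟧ v v′) b →
              σ ⊢ e ⟨ r ⟩ e′ ⇓ᵗ b

  -- ⟨ c , σ ⟩⇓⟨ σ′ ⟩ t : started in σ, c halts in σ′ after time t.
  data ⟨_,_⟩⇓⟨_⟩_ : Cmd → Store → Store → ℕ → Set where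

    skip : ∀ {σ} → ⟨ skip , σ ⟩⇓⟨ σ ⟩ 1

    assign : ∀ {σ x e v} → σ ⊢ e ⇓ v →
      ⟨ x ≔ e , σ ⟩⇓⟨ setScalar x v σ ⟩ (1 + exprCost e)

    assignCell : ∀ {σ b e e′ i v} → σ ⊢ e ⇓ [ # i ] → σ ⊢ e′ ⇓ v →
      ⟨ b [ e ]≔ e′ , σ ⟩⇓⟨ setCell b i v σ ⟩ (1 + exprCost e + exprCost e′)

    seq : ∀ {c c′ σ σ′ σ″ t t′} →
      ⟨ c , σ ⟩⇓⟨ σ′ ⟩ t → ⟨ c′ , σ′ ⟩⇓⟨ σ″ ⟩ t′ →
      ⟨ c ⨾ c′ , σ ⟩⇓⟨ σ″ ⟩ (t + t′)

    if-true : ∀ {b c c′ σ σ′ t} →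
      σ ⊢ b ⇓ᵗ true → ⟨ c , σ ⟩⇓⟨ σ′ ⟩ t →
      ⟨ if b then c else c′ , σ ⟩⇓⟨ σ′ ⟩ (testCost b + t)

    if-false : ∀ {b c c′ σ σ′ t} →
      σ ⊢ b ⇓ᵗ false → ⟨ c′ , σ ⟩⇓⟨ σ′ ⟩ t →
      ⟨ if b then c else c′ , σ ⟩⇓⟨ σ′ ⟩ (testCost b + t)

    while-true : ∀ {b c σ σ′ σ″ t t′} →
      σ ⊢ b ⇓ᵗ true → ⟨ c , σ ⟩⇓⟨ σ′ ⟩ t →
      ⟨ while b loop c , σ′ ⟩⇓⟨ σ″ ⟩ t′ →
      ⟨ while b loop c , σ ⟩⇓⟨ σ″ ⟩ (testCost b + t + t′)

    while-false : ∀ {b c σ} →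
      σ ⊢ b ⇓ᵗ false →
      ⟨ while b loop c , σ ⟩⇓⟨ σ ⟩ (testCost b)

-- Scalar 0 holds n at the start, scalar 1 the result at the end, and array 0
-- the input array.
record Program : Set where
  field
    scalars arrays : ℕ
  open Syntax (2 + scalars) (1 + arrays)
  field
    body : Cmd

module Execution (P : Program) (n : ℕ) where
  open Program P
  open Semantics (2 + scalars) (1 + arrays) n public

  -- The remaining memory has arbitrary initial contents.
  record Initial (input : Vector ℕ n) (σ : Store) : Set where
    field
      size   : scalar σ zero ≡ [ n ]
      loaded : ∀ i → array σ zero i ≡ [ input i ]

  OutputsWithin : ℕ → Vector ℕ n → (ℕ → Set) → Set
  OutputsWithin bound input Correct = ∀ σ → Initial input σ →
    ∃[ σ′ ] ∃[ t ] ∃[ m ]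
      (⟨ body , σ ⟩⇓⟨ σ′ ⟩ t) × t ≤ bound
      × scalar σ′ (suc zero) ≡ [ m ] × Correct m

{-# OPTIONS --safe #-}
module Submission where

-- Dynamic programming from the leaves to the root.  A partial solution is seen from
-- a vertex v only through whether v is chosen and, if not, how many of its children
-- are; counts above k are ruled out, so a vertex has k + 2 states.  Going through the
-- vertices from n down to 2, each vertex is merged into its parent by a (min,+)
-- product over pairs of states, which takes constant time for fixed k.
--
-- When the vertices from t onwards have been merged, the entries of the tables at the
-- remaining vertices are the exact optima in the following sense: every choice of one
-- finite entry per remaining vertex is realised by a vertex set whose size is the
-- sum of these entries, and every dominating set has size at least the sum of the
-- entries that it selects.  This avoids any reference to subtrees, and since the sum
-- is the size of a vertex set it also keeps all operands at most n.

open import Defs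
import Algebra.Properties.CommutativeMonoid.Sum
open import Data.Bool.Base using (Bool; true; false; _∧_) renaming (if_then_else_ to ifᵇ_then_else_)
open import Data.Bool.Properties using (∧-zeroʳ)
open import Data.Empty using (⊥)
open import Data.Fin.Base using (Fin; zero; suc; toℕ; fromℕ<)
open import Data.Fin.Properties using (toℕ-injective; toℕ-fromℕ<; toℕ<n; _≟_)
open import Data.Fin.Subset using (Subset; _∩_; ∣_∣; ⊤)
open import Data.Fin.Subset.Properties using (∣p∣≤n)
open import Data.List.Base using (List; []; _∷_; foldr; allFin; cartesianProduct)
open import Data.List.Membership.Propositional using (_∈_)
open import Data.List.Membership.Propositional.Properties using (∈-allFin; ∈-cartesianProduct⁺)
open import Data.List.Relation.Unary.Any using (here; there)
open import Data.Maybe.Base using (Maybe; just; nothing; map; maybe′)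
open import Data.Nat.Base using (ℕ; zero; suc; pred; _+_; _*_; _≤_; _<_; z≤n; s≤s; s≤s⁻¹; >-nonZero; >-nonZero⁻¹)
open import Data.Nat.Properties hiding (_≟_)
open import Data.Nat.Tactic.RingSolver using (solve-∀)
open import Data.Product.Base using (_×_; _,_; proj₁; proj₂; ∃-syntax; Σ-syntax)
open import Data.Sum.Base using (_⊎_; inj₁; inj₂)
open import Data.Vec.Base using ([]; _∷_; lookup; tabulate)
open import Data.Vec.Functional using (Vector; updateAt)
open import Data.Vec.Functional.Properties using (updateAt-updates; updateAt-minimal)
open import Data.Vec.Properties using (lookup∘tabulate; lookup-zipWith; []=⇒lookup; lookup⇒[]=; lookup-replicate)
open import Function.Base using (const; id; _∘_)
open import Function.Bundles using (Equivalence)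
open import Relation.Binary.Construct.Add.Supremum.NonStrict _≤_ using (_≤⁺_; _≤⊤⁺; ≤⁺-trans)
open import Relation.Binary.Construct.Add.Supremum.Strict _<_ using (_<⁺_; <⁺-dec)
open import Relation.Binary.Definitions using (tri<; tri≈; tri>)
open import Relation.Binary.PropositionalEquality
open import Relation.Nullary.Construct.Add.Supremum using ([_]; ⊤⁺)
open import Relation.Nullary.Decidable using (Dec; yes; no; does; dec-true; dec-false)
open import Relation.Nullary.Negation.Core using (¬_; contradiction)
open import Relation.Nullary.Reflects using (Reflects; ofʸ; ofⁿ)
import Data.Maybe.Relation.Unary.All as All
import Relation.Binary.Construct.Add.Supremum.NonStrict _≤_ as NonStrict
import Relation.Binary.Construct.Add.Supremum.Strict _<_ as Strict

open Algebra.Properties.CommutativeMonoid.Sum +-0-commutativeMonoid using (sum; sum-cong-≗; sum-replicate-zero)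
open ≡-Reasoning

-- Sums of vectors that change at one or two coordinates

module _ {n : ℕ} {p i : Fin n} where

  -- When a vertex `i` is merged into its parent `p`, a selection of states or of entries has to be
  -- edited at these two vertices only.
  override₂ : {A : Set} → A → A → Vector A n → Vector A n
  override₂ x y f = updateAt (updateAt f p (const x)) i (const y)

  module _ {A : Set} {x y : A} (f : Vector A n) (p≢i : p ≢ i) where

    override₂-fst : override₂ x y f p ≡ x
    override₂-fst = trans (updateAt-minimal p i _ p≢i) (updateAt-updates p f)

    override₂-snd : override₂ x y f i ≡ y
    override₂-snd = updateAt-updates i _

    override₂-other : ∀ {v} → v ≢ p → v ≢ i → override₂ x y f v ≡ f v
    override₂-other {v} v≢p v≢i = trans (updateAt-minimal v i _ v≢i) (updateAt-minimal v p f v≢p)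

sum-extract : ∀ {n} (f : Vector ℕ n) x → sum f ≡ f x + sum (updateAt f x (const 0))
sum-extract f zero    = refl
sum-extract f (suc x) = begin
  f zero + sum (f ∘ suc)
    ≡⟨ cong (f zero +_) (sum-extract (f ∘ suc) x) ⟩
  f zero + (f (suc x) + rest)
    ≡⟨ +-assoc (f zero) _ _ ⟨
  f zero + f (suc x) + rest
    ≡⟨ cong (_+ rest) (+-comm (f zero) _) ⟩
  f (suc x) + f zero + rest
    ≡⟨ +-assoc (f (suc x)) _ _ ⟩
  f (suc x) + (f zero + rest) ∎
  where rest = sum (updateAt (f ∘ suc) x (const 0))

updateAt-agree : ∀ {n} {A : Set} {f g : Vector A n} {x c} → (∀ u → u ≢ x → f u ≡ g u) →
                 ∀ u → updateAt f x (const c) u ≡ updateAt g x (const c) u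
updateAt-agree {f = f} {g} {x} agree u with u ≟ x
... | yes refl = trans (updateAt-updates x f) (sym (updateAt-updates x g))
... | no u≢x   = trans (updateAt-minimal u x f u≢x)
                       (trans (agree u u≢x) (sym (updateAt-minimal u x g u≢x)))

sum-differ-at : ∀ {n} {f g : Vector ℕ n} {d} x → (∀ u → u ≢ x → f u ≡ g u) →
                f x ≡ g x + d → sum f ≡ sum g + d
sum-differ-at {f = f} {g} {d} x agree fx = begin
  sum f                ≡⟨ sum-extract f x ⟩
  f x + sum f′         ≡⟨ cong₂ _+_ fx (sum-cong-≗ (updateAt-agree agree)) ⟩
  g x + d + sum g′     ≡⟨ +-assoc (g x) d _ ⟩
  g x + (d + sum g′)   ≡⟨ cong (g x +_) (+-comm d _) ⟩
  g x + (sum g′ + d)   ≡⟨ +-assoc (g x) _ d ⟨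
  g x + sum g′ + d     ≡⟨ cong (_+ d) (sum-extract g x) ⟨
  sum g + d            ∎
  where
  f′ = updateAt f x (const 0)
  g′ = updateAt g x (const 0)

sum-extract₂ : ∀ {n} (f : Vector ℕ n) {p i} → p ≢ i →
               sum f ≡ (f p + f i) + sum (override₂ {p = p} {i} 0 0 f)
sum-extract₂ f {p} {i} p≢i = begin
  sum f                       ≡⟨ sum-extract f p ⟩
  f p + sum f′                ≡⟨ cong (f p +_) (sum-extract f′ i) ⟩
  f p + (f′ i + rest)         ≡⟨ cong (λ x → f p + (x + rest)) (updateAt-minimal i p f (p≢i ∘ sym)) ⟩
  f p + (f i + rest)          ≡⟨ +-assoc (f p) _ _ ⟨
  f p + f i + rest            ∎
  where
  f′   = updateAt f p (const 0)
  rest = sum (updateAt f′ i (const 0))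

-- Setting coordinates `p` and `i` to zero makes the two vectors equal, so the sums differ only in
-- what these two contribute. This accounts for weight that moves between a child and its parent.
sum-transfer-≤ : ∀ {n} {f g : Vector ℕ n} {p i} → p ≢ i →
                 (∀ v → v ≢ p → v ≢ i → f v ≡ g v) → f p + f i ≤ g p + g i → sum f ≤ sum g
sum-transfer-≤ {f = f} {g} {p} {i} p≢i agree f≤g = subst₂ _≤_
  (sym (trans (sum-extract₂ f p≢i) (cong (f p + f i +_) (sum-cong-≗ rest≗))))
  (sym (sum-extract₂ g p≢i))
  (+-monoˡ-≤ _ f≤g)
  where
  rest≗ : ∀ v → override₂ {p = p} {i} 0 0 f v ≡ override₂ {p = p} {i} 0 0 g v
  rest≗ = updateAt-agree λ v v≢i → within v v≢i
    where
    within : ∀ v → v ≢ i → updateAt f p (const 0) v ≡ updateAt g p (const 0) v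
    within v v≢i with v ≟ p
    ... | yes refl = trans (updateAt-updates p f) (sym (updateAt-updates p g))
    ... | no v≢p   = trans (updateAt-minimal v p f v≢p)
                       (trans (agree v v≢p v≢i) (sym (updateAt-minimal v p g v≢p)))

sum-transfer : ∀ {n} {f g : Vector ℕ n} {p i} → p ≢ i →
               (∀ v → v ≢ p → v ≢ i → f v ≡ g v) → f p + f i ≡ g p + g i → sum f ≡ sum g
sum-transfer p≢i agree eqn = ≤-antisym
  (sum-transfer-≤ p≢i agree (≤-reflexive eqn))
  (sum-transfer-≤ p≢i (λ v v≢p v≢i → sym (agree v v≢p v≢i)) (≤-reflexive (sym eqn)))

sum-mono-≤ : ∀ {n} {f g : Vector ℕ n} → (∀ v → f v ≤ g v) → sum f ≤ sum g
sum-mono-≤ {zero}  f≤g = z≤n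
sum-mono-≤ {suc n} f≤g = +-mono-≤ (f≤g zero) (sum-mono-≤ (f≤g ∘ suc))

-- Cardinalities as sums, and finite values of `ℕ∞`

bit : Bool → ℕ
bit true  = 1
bit false = 0

∣p∣≡sum : ∀ {n} (p : Subset n) → ∣ p ∣ ≡ sum (bit ∘ lookup p)
∣p∣≡sum []          = refl
∣p∣≡sum (true  ∷ p) = cong suc (∣p∣≡sum p)
∣p∣≡sum (false ∷ p) = ∣p∣≡sum p

+∞-finite : ∀ {x y m} → x +∞ y ≡ [ m ] → ∃[ a ] ∃[ b ] x ≡ [ a ] × y ≡ [ b ] × a + b ≡ m
+∞-finite {[ a ]} {[ b ]} refl = a , b , refl , refl , refl

≤⁺-finite : ∀ {x m} → x ≤⁺ [ m ] → ∃[ a ] x ≡ [ a ] × a ≤ m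
≤⁺-finite NonStrict.[ f≤g ] = _ , refl , f≤g

-- States of a vertex and their transitions

module Automaton (k : ℕ) where

  -- In: the vertex is chosen.  Out j: it is not, and exactly j of its children merged so far are.
  State : Set
  State = Fin (2 + k)

  pattern In    = zero
  pattern Out j = suc j

  -- The first argument is the state of the parent, the second that of the child, whose own children
  -- have all been merged. Domination of the child is therefore decided here: a chosen parent raises
  -- the child's count by one, an unchosen parent requires that count to be positive already.
  -- `nothing` marks a pair that leaves the child undominated or lets a count exceed `k`.
  δ : State → State → Maybe State
  δ In      In            = just In
  δ In      (Out j)       with toℕ j <? k
  ... | yes _             = just In
  ... | no _              = nothing
  δ (Out j) In            with toℕ j <? k
  ... | yes j<k           = just (Out (fromℕ< (s≤s j<k)))
  ... | no _              = nothing
  δ (Out j) (Out zero)    = nothing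
  δ (Out j) (Out (suc _)) = just (Out j)

  -- No child has been merged yet, so a positive count is impossible and has infinite cost.
  start : State → ℕ∞
  start In            = [ 1 ]
  start (Out zero)    = [ 0 ]
  start (Out (suc _)) = ⊤⁺

  -- The root has no parent that could still dominate it, so `Out zero` is the one state left out.
  accepting : Fin (suc k) → State
  accepting zero    = In
  accepting (suc j) = Out (suc j)

-- Neighbour counts, meaning of the states, and the invariant of the tables

module Tables (k : ℕ) {n : ℕ} (T : Graph n) (Parent : Vector ℕ n) (isParentArray : IsParentArray T Parent) where

  open Automaton k
  open Graph T renaming (sym to adj-sym)
  open IsParentArray isParentArray

  link : Subset n → Fin n → Fin n → ℕ
  link S v u = bit (lookup S u ∧ does (adj? v u))

  -- Cutting off summands, instead of restricting the index range, keeps every count a sum over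
  -- `Fin n`, so that counts for different thresholds can be compared term by term.
  from : ℕ → ℕ → ℕ → ℕ
  from t u x = ifᵇ does (t ≤? u) then x else 0

  from-≤ : ∀ {t u x} → t ≤ u → from t u x ≡ x
  from-≤ {t} {u} t≤u rewrite dec-true (t ≤? u) t≤u = refl

  from-> : ∀ {t u x} → u < t → from t u x ≡ 0
  from-> {t} {u} u<t rewrite dec-false (t ≤? u) (<⇒≱ u<t) = refl

  -- The S-neighbours of v numbered from t onwards.  For v below t these are the
  -- children of v in S among the vertices already merged into their parents.
  count : ℕ → Subset n → Fin n → ℕ
  count t S v = sum λ u → from t (toℕ u) (link S v u)

  count₀ : ∀ S v → count 0 S v ≡ ∣ S ∩ neighbours v ∣
  count₀ S v = sym (trans (∣p∣≡sum (S ∩ neighbours v)) (sum-cong-≗ λ u → cong bit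
    (trans (lookup-zipWith _∧_ u S (neighbours v)) (cong (lookup S u ∧_) (lookup∘tabulate _ u)))))

  countₙ : ∀ S v → count n S v ≡ 0
  countₙ S v = trans (sum-cong-≗ {x = λ u → from n (toℕ u) (link S v u)} {y = const 0} (λ u → from-> (toℕ<n u))) (sum-replicate-zero n)

  count≤count₀ : ∀ t S v → count t S v ≤ count 0 S v
  count≤count₀ t S v = sum-mono-≤ {f = λ u → from t (toℕ u) (link S v u)} {g = link S v} λ u → bound (does (t ≤? toℕ u))
    where
    bound : ∀ {x} b → (ifᵇ b then x else 0) ≤ x
    bound true  = ≤-refl
    bound false = z≤n

  link-adj : ∀ S {v u} → Adj v u → link S v u ≡ bit (lookup S u)
  link-adj S {v} {u} a rewrite dec-true (adj? v u) a with lookup S u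
  ... | true  = refl
  ... | false = refl

  link-¬adj : ∀ S {v u} → (Adj v u → ⊥) → link S v u ≡ 0
  link-¬adj S {v} {u} ¬a rewrite dec-false (adj? v u) ¬a | ∧-zeroʳ (lookup S u) = refl

  HasState : ℕ → Subset n → Fin n → State → Set
  HasState t S v In      = lookup S v ≡ true
  HasState t S v (Out j) = lookup S v ≡ false × count t S v ≡ toℕ j

  Satisfied : Subset n → Fin n → Set
  Satisfied S v = lookup S v ≡ false → 1 ≤ count 0 S v × count 0 S v ≤ k

  dominating⇒satisfied : ∀ {S} → QuasiperfectDominating k T S → ∀ v → Satisfied S v
  dominating⇒satisfied {S} qd v S[v] rewrite count₀ S v = qd v λ v∈S →
    contradiction (trans (sym ([]=⇒lookup v∈S)) S[v]) λ ()

  satisfied⇒dominating : ∀ {S} → (∀ v → Satisfied S v) → QuasiperfectDominating k T S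
  satisfied⇒dominating {S} sat v v∉S = subst (λ c → 1 ≤ c × c ≤ k) (count₀ S v) (sat v S[v])
    where
    S[v] : lookup S v ≡ false
    S[v] with lookup S v in eqn
    ... | true  = contradiction (lookup⇒[]= v S eqn) v∉S
    ... | false = refl

  -- The vector `m` holds the selected entries and is zero at the merged vertices, so `sum m` is the
  -- total over the remaining ones. `Complete` asks only for `sum m ≤ ∣ S ∣`, because the merged
  -- part of `S` need not be optimal for the states that it induces.
  Sound Complete : ℕ → (State → Fin n → ℕ∞) → Set
  Sound t A = ∀ (q : Vector State n) (m : Vector ℕ n) →
    (∀ v → toℕ v < t → A (q v) v ≡ [ m v ]) → (∀ v → t ≤ toℕ v → m v ≡ 0) →
    ∃[ S ] (∀ v → toℕ v < t → HasState t S v (q v))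
         × (∀ v → t ≤ toℕ v → Satisfied S v)
         × ∣ S ∣ ≡ sum m
  Complete t A = ∀ S → (∀ v → Satisfied S v) →
    Σ[ q ∈ Vector State n ] Σ[ m ∈ Vector ℕ n ]
      (∀ v → toℕ v < t → A (q v) v ≡ [ m v ] × HasState t S v (q v))
      × (∀ v → t ≤ toℕ v → m v ≡ 0)
      × sum m ≤ ∣ S ∣

  record Invariant (t : ℕ) (A : State → Fin n → ℕ∞) : Set where
    field
      sound    : Sound t A
      complete : Complete t A

  -- No vertex lies outside the full set. It is the feasible solution that supplies finite entries
  -- wherever some are needed.
  ⊤-satisfied : ∀ v → Satisfied ⊤ v
  ⊤-satisfied v ⊤[v] = contradiction (trans (sym (lookup-replicate v true)) ⊤[v]) λ ()

  -- With nothing merged, every count is zero, and a selection of finite entries is just the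
  -- characteristic function of a vertex set, whose size is the sum of the entries.
  invariant-start : ∀ {A} → (∀ q v → A q v ≡ start q) → Invariant n A
  invariant-start {A} A≡start = record { sound = sound ; complete = complete }
    where
    isIn : State → Bool
    isIn In      = true
    isIn (Out _) = false

    sound : Sound n A
    sound q m fin _ = S , states , (λ v n≤v → contradiction n≤v (<⇒≱ (toℕ<n v))) ,
      trans (∣p∣≡sum S) (sum-cong-≗ λ v → trans (cong bit (S[ v ])) (size (q v) (cell v)))
      where
      S = tabulate (isIn ∘ q)
      S[_] : ∀ v → lookup S v ≡ isIn (q v)
      S[ v ] = lookup∘tabulate _ v
      cell : ∀ v → start (q v) ≡ [ m v ]
      cell v = trans (sym (A≡start (q v) v)) (fin v (toℕ<n v))
      size : ∀ s {x} → start s ≡ [ x ] → bit (isIn s) ≡ x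
      size In         refl = refl
      size (Out zero) refl = refl
      states : ∀ v → toℕ v < n → HasState n S v (q v)
      -- Matching on `cell v` excludes the states `Out (suc _)`, whose start value is infinite.
      states v _ with q v | S[ v ] | cell v
      ... | In       | S[v] | _ = S[v]
      ... | Out zero | S[v] | _ = S[v] , countₙ S v

    complete : Complete n A
    complete S _ = state ∘ lookup S , bit ∘ lookup S ,
      (λ v _ → trans (A≡start _ v) (cell (lookup S v)) , states v) ,
      (λ v n≤v → contradiction n≤v (<⇒≱ (toℕ<n v))) ,
      ≤-reflexive (sym (∣p∣≡sum S))
      where
      state : Bool → State
      state true  = In
      state false = Out zero
      cell : ∀ b → start (state b) ≡ [ bit b ]
      cell true  = refl
      cell false = refl
      states : ∀ v → HasState n S v (state (lookup S v))
      states v with lookup S v in eqn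
      ... | true  = eqn
      ... | false = eqn , countₙ S v

  -- Merging a vertex into its parent

  module Merge {i p : Fin n} (p-parent : p ParentOf i) where

    p<i : toℕ p < toℕ i
    p<i = s≤s⁻¹ (increasing p i p-parent)

    p≢i : p ≢ i
    p≢i refl = <-irrefl refl p<i

    p~i : Adj p i
    p~i = Equivalence.from (edges p i) (inj₁ p-parent)

    onlyParent : ∀ {v} → v ParentOf i → v ≡ p
    onlyParent (_ , eqn) = toℕ-injective (suc-injective (trans (sym eqn) (proj₂ p-parent)))

    -- On every edge the smaller number belongs to the parent, and the parent of `i` is unique.
    below-¬adj : ∀ {v} → toℕ v < toℕ i → v ≢ p → Adj v i → ⊥
    below-¬adj {v} v<i v≢p a with Equivalence.to (edges v i) a
    ... | inj₁ v-parent = v≢p (onlyParent v-parent)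
    ... | inj₂ i-parent = <-asym v<i (s≤s⁻¹ (increasing i v i-parent))

    -- Lowering the threshold by one admits exactly one new summand, the one at `i`.
    count-step : ∀ S v → count (toℕ i) S v ≡ count (suc (toℕ i)) S v + link S v i
    count-step S v = sum-differ-at i agree at-i
      where
      agree : ∀ u → u ≢ i → from (toℕ i) (toℕ u) (link S v u) ≡ from (suc (toℕ i)) (toℕ u) (link S v u)
      agree u u≢i with <-cmp (toℕ i) (toℕ u)
      ... | tri< i<u _ _ = trans (from-≤ (<⇒≤ i<u)) (sym (from-≤ i<u))
      ... | tri≈ _ i≡u _ = contradiction (toℕ-injective (sym i≡u)) u≢i
      ... | tri> _ _ u<i = trans (from-> u<i) (sym (from-> (m<n⇒m<1+n u<i)))
      at-i : from (toℕ i) (toℕ i) (link S v i) ≡ from (suc (toℕ i)) (toℕ i) (link S v i) + link S v i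
      at-i = trans (from-≤ {toℕ i} ≤-refl) (cong (_+ link S v i) (sym (from-> {u = toℕ i} ≤-refl)))

    count-parent : ∀ S → count (toℕ i) S p ≡ count (suc (toℕ i)) S p + bit (lookup S i)
    count-parent S = trans (count-step S p) (cong (count (suc (toℕ i)) S p +_) (link-adj S p~i))

    count-other : ∀ S {v} → toℕ v < toℕ i → v ≢ p → count (toℕ i) S v ≡ count (suc (toℕ i)) S v
    count-other S {v} v<i v≢p = trans (count-step S v)
      (trans (cong (count (suc (toℕ i)) S v +_) (link-¬adj S (below-¬adj v<i v≢p))) (+-identityʳ _))

    -- The neighbours of `i` are its children, all numbered above `i`, and `p`. Hence the final
    -- count at `i` is known as soon as the choice at `p` is.
    count-merged : ∀ S → count 0 S i ≡ count (suc (toℕ i)) S i + bit (lookup S p)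
    count-merged S = sum-differ-at p agree at-p
      where
      agree : ∀ u → u ≢ p → link S i u ≡ from (suc (toℕ i)) (toℕ u) (link S i u)
      agree u u≢p with suc (toℕ i) ≤? toℕ u
      ... | yes i<u = sym (from-≤ i<u)
      ... | no i≮u  = trans (link-¬adj S ¬a) (sym (from-> (≰⇒> i≮u)))
        where
        ¬a : Adj i u → ⊥
        ¬a a with Equivalence.to (edges i u) a
        ... | inj₁ i-parent = i≮u (s≤s⁻¹ (increasing i u i-parent))
        ... | inj₂ u-parent = u≢p (onlyParent u-parent)
      at-p : link S i p ≡ from (suc (toℕ i)) (toℕ p) (link S i p) + bit (lookup S p)
      at-p = trans (link-adj S (adj-sym p~i)) (cong (_+ bit (lookup S p)) (sym (from-> (m<n⇒m<1+n p<i))))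

    module _ {S : Subset n} where

      HasState-other : ∀ {v} → toℕ v < toℕ i → v ≢ p → ∀ q →
                       HasState (suc (toℕ i)) S v q → HasState (toℕ i) S v q
      HasState-other v<i v≢p In      h       = h
      HasState-other v<i v≢p (Out j) (h , c) = h , trans (count-other S v<i v≢p) c

      -- By `count-merged` the state pair determines the final count at `i`, and by `count-parent`
      -- the count at `p` grows by one exactly when `i` is chosen; the cases of `δ` record both
      -- effects.
      δ-sound : ∀ q q′ {q″} → HasState (suc (toℕ i)) S p q → HasState (suc (toℕ i)) S i q′ →
                δ q q′ ≡ just q″ → HasState (toℕ i) S p q″ × Satisfied S i
      δ-sound In In Sp Si refl = Sp , λ S[i] → contradiction (trans (sym Si) S[i]) λ ()
      δ-sound In (Out j) Sp (Si , ci) eqn with toℕ j <? k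
      δ-sound In (Out j) Sp (Si , ci) refl | yes j<k = Sp , λ _ →
        subst (λ c → 1 ≤ c × c ≤ k) (sym total) (s≤s z≤n , j<k)
        where
        total : count 0 S i ≡ suc (toℕ j)
        total rewrite count-merged S | Sp | ci = +-comm (toℕ j) 1
      δ-sound (Out j) In (Sp , cp) Si eqn with toℕ j <? k
      δ-sound (Out j) In (Sp , cp) Si refl | yes j<k =
        (Sp , total) , λ S[i] → contradiction (trans (sym Si) S[i]) λ ()
        where
        total : count (toℕ i) S p ≡ toℕ (fromℕ< (s≤s j<k))
        total rewrite count-parent S | Si | cp | toℕ-fromℕ< (s≤s j<k) = +-comm (toℕ j) 1
      δ-sound (Out j) (Out (suc j′)) (Sp , cp) (Si , ci) refl =
        (Sp , total-p) , λ _ → subst (λ c → 1 ≤ c × c ≤ k) (sym total-i) (s≤s z≤n , toℕ<n j′)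
        where
        total-p : count (toℕ i) S p ≡ toℕ j
        total-p rewrite count-parent S | Si | cp = +-identityʳ _
        total-i : count 0 S i ≡ suc (toℕ j′)
        total-i rewrite count-merged S | Sp | ci = +-identityʳ _

      -- The converse of `δ-sound`: each pair that `δ` rejects would violate the condition at `i` or
      -- at `p`.
      δ-complete : (∀ v → Satisfied S v) → ∀ q q′ →
                   HasState (suc (toℕ i)) S p q → HasState (suc (toℕ i)) S i q′ →
                   ∃[ q″ ] δ q q′ ≡ just q″ × HasState (toℕ i) S p q″
      δ-complete sat In In Sp Si = In , refl , Sp
      δ-complete sat In (Out j) Sp (Si , ci) with toℕ j <? k
      ... | yes _  = In , refl , Sp
      ... | no j≮k = contradiction (subst (_≤ k) total (proj₂ (sat i Si))) j≮k
        where
        total : count 0 S i ≡ suc (toℕ j)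
        total rewrite count-merged S | Sp | ci = +-comm (toℕ j) 1
      δ-complete sat (Out j) In (Sp , cp) Si with toℕ j <? k
      ... | yes j<k = _ , refl , Sp , trans total (sym (toℕ-fromℕ< (s≤s j<k)))
        where
        total : count (toℕ i) S p ≡ suc (toℕ j)
        total rewrite count-parent S | Si | cp = +-comm (toℕ j) 1
      -- The count at `p` never exceeds its final value, so passing `k` at this stage already
      -- contradicts `sat p`.
      ... | no j≮k  = contradiction
        (≤-trans (subst (_≤ count 0 S p) total (count≤count₀ (toℕ i) S p)) (proj₂ (sat p Sp))) j≮k
        where
        total : count (toℕ i) S p ≡ suc (toℕ j)
        total rewrite count-parent S | Si | cp = +-comm (toℕ j) 1
      δ-complete sat (Out j) (Out zero) (Sp , cp) (Si , ci) =
        contradiction (subst (1 ≤_) total (proj₁ (sat i Si))) λ ()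
        where
        total : count 0 S i ≡ 0
        total rewrite count-merged S | Sp | ci = refl
      δ-complete sat (Out j) (Out (suc j′)) (Sp , cp) (Si , ci) = _ , refl , Sp , total
        where
        total : count (toℕ i) S p ≡ toℕ j
        total rewrite count-parent S | Si | cp = +-identityʳ _

    data Position (v : Fin n) : Set where
      parent : v ≡ p → Position v
      merged : v ≡ i → Position v
      other  : v ≢ p → v ≢ i → Position v

    position : ∀ v → Position v
    position v with v ≟ p | v ≟ i
    ... | yes eqn | _      = parent eqn
    ... | no _   | yes eqn = merged eqn
    ... | no v≢p | no v≢i = other v≢p v≢i

    active : ∀ {v} → toℕ v < suc (toℕ i) → v ≢ i → toℕ v < toℕ i
    active v≤i v≢i = ≤∧≢⇒< (s≤s⁻¹ v≤i) (v≢i ∘ toℕ-injective)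

    -- Column `p` of `A′` is the (min,+) product of columns `p` and `i` of `A` along `δ`. It is
    -- described by the two defining properties of a minimum, the form in which the program's
    -- relaxations deliver it.
    record IsMerge (A A′ : State → Fin n → ℕ∞) : Set where
      field
        unchanged : ∀ q v → v ≢ p → A′ q v ≡ A q v
        lower     : ∀ q q′ {q″} → δ q q′ ≡ just q″ → A′ q″ p ≤⁺ A q p +∞ A q′ i
        attained  : ∀ q″ → A′ q″ p ≡ ⊤⁺ ⊎
                    (∃[ q ] ∃[ q′ ] δ q q′ ≡ just q″ × A′ q″ p ≡ A q p +∞ A q′ i)

    module _ {A} (inv : Invariant (suc (toℕ i)) A) where
      open Invariant inv

      -- The two entries are completed to a full selection by those that `⊤` selects at the other
      -- vertices. Soundness realises this selection by a vertex set, which has at most `n`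
      -- elements.
      sum-bounded : ∀ {q q′ a b} → A q p ≡ [ a ] → A q′ i ≡ [ b ] → a + b ≤ n
      sum-bounded {q} {q′} {a} {b} Aqp Aq′i =
        ≤-trans total (subst (_≤ n) (proj₂ (proj₂ (proj₂ found))) (∣p∣≤n (proj₁ found)))
        where
        q₀ = proj₁ (complete ⊤ ⊤-satisfied)
        m₀ = proj₁ (proj₂ (complete ⊤ ⊤-satisfied))
        spec = proj₂ (proj₂ (complete ⊤ ⊤-satisfied))
        q₁ = override₂ {p = p} {i} q q′ q₀
        m₁ = override₂ {p = p} {i} a b m₀
        cells : ∀ v → toℕ v < suc (toℕ i) → A (q₁ v) v ≡ [ m₁ v ]
        cells v v≤i with position v
        ... | parent refl rewrite override₂-fst {x = q} {q′} q₀ p≢i | override₂-fst {x = a} {b} m₀ p≢i = Aqp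
        ... | merged refl rewrite override₂-snd {x = q} {q′} q₀ p≢i | override₂-snd {x = a} {b} m₀ p≢i = Aq′i
        ... | other v≢p v≢i
              rewrite override₂-other {x = q} {q′} q₀ p≢i v≢p v≢i
                    | override₂-other {x = a} {b} m₀ p≢i v≢p v≢i = proj₁ (proj₁ spec v v≤i)
        zeros : ∀ v → suc (toℕ i) ≤ toℕ v → m₁ v ≡ 0
        zeros v i<v with position v
        ... | parent refl = contradiction i<v (<-asym p<i)
        ... | merged refl = contradiction i<v (<-irrefl refl)
        ... | other v≢p v≢i = trans (override₂-other m₀ p≢i v≢p v≢i) (proj₁ (proj₂ spec) v i<v)
        found = sound q₁ m₁ cells zeros
        total : a + b ≤ sum m₁
        total = subst₂ (λ x y → x + y ≤ sum m₁) (override₂-fst m₀ p≢i) (override₂-snd m₀ p≢i)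
          (subst (m₁ p + m₁ i ≤_) (sym (sum-extract₂ m₁ p≢i)) (m≤m+n _ _))

      -- For soundness, the entry at `p` is split into the entries at `p` and `i` that attain it,
      -- and the old invariant is applied. For completeness, the entries that `S` selects at `p` and
      -- `i` are replaced by a single one at `p`, which costs no more than both together.
      invariant-merge : ∀ {A′} → IsMerge A A′ → Invariant (toℕ i) A′
      invariant-merge {A′} isMerge = record { sound = sound′ ; complete = complete′ }
        where
        open IsMerge isMerge

        sound′ : Sound (toℕ i) A′
        sound′ q m cells′ zeros′ with attained (q p)
        ... | inj₁ infinite = contradiction (trans (sym (cells′ p p<i)) infinite) λ ()
        ... | inj₂ (q₁ , q₂ , step , Aqp)
            with a , b , Aq₁p , Aq₂i , a+b≡mp ← +∞-finite (trans (sym Aqp) (cells′ p p<i)) =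
          S , states , satisfied , trans size (sum-transfer p≢i
            (λ v v≢p v≢i → override₂-other m p≢i v≢p v≢i)
            (trans (cong₂ _+_ (override₂-fst m p≢i) (override₂-snd m p≢i))
              (trans a+b≡mp (sym (trans (cong (m p +_) (zeros′ i ≤-refl)) (+-identityʳ _))))))
          where
          q₊ = override₂ {p = p} {i} q₁ q₂ q
          m₊ = override₂ {p = p} {i} a b m
          cells : ∀ v → toℕ v < suc (toℕ i) → A (q₊ v) v ≡ [ m₊ v ]
          cells v v≤i with position v
          ... | parent refl rewrite override₂-fst {x = q₁} {q₂} q p≢i | override₂-fst {x = a} {b} m p≢i = Aq₁p
          ... | merged refl rewrite override₂-snd {x = q₁} {q₂} q p≢i | override₂-snd {x = a} {b} m p≢i = Aq₂i
          ... | other v≢p v≢i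
                rewrite override₂-other {x = q₁} {q₂} q p≢i v≢p v≢i
                      | override₂-other {x = a} {b} m p≢i v≢p v≢i =
                trans (sym (unchanged (q v) v v≢p)) (cells′ v (active v≤i v≢i))
          zeros : ∀ v → suc (toℕ i) ≤ toℕ v → m₊ v ≡ 0
          zeros v i<v with position v
          ... | parent refl = contradiction i<v (<-asym p<i)
          ... | merged refl = contradiction i<v (<-irrefl refl)
          ... | other v≢p v≢i = trans (override₂-other m p≢i v≢p v≢i) (zeros′ v (<⇒≤ i<v))
          found = sound q₊ m₊ cells zeros
          S = proj₁ found
          states₊ = proj₁ (proj₂ found)
          size = proj₂ (proj₂ (proj₂ found))
          stepped : HasState (toℕ i) S p (q p) × Satisfied S i
          stepped = δ-sound q₁ q₂
            (subst (HasState _ S p) (override₂-fst q p≢i) (states₊ p (m≤n⇒m≤1+n p<i)))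
            (subst (HasState _ S i) (override₂-snd q p≢i) (states₊ i ≤-refl)) step
          states : ∀ v → toℕ v < toℕ i → HasState (toℕ i) S v (q v)
          states v v<i with position v
          ... | parent refl = proj₁ stepped
          ... | merged refl = contradiction v<i (<-irrefl refl)
          ... | other v≢p v≢i = HasState-other v<i v≢p (q v)
                  (subst (HasState _ S v) (override₂-other q p≢i v≢p v≢i) (states₊ v (m≤n⇒m≤1+n v<i)))
          satisfied : ∀ v → toℕ i ≤ toℕ v → Satisfied S v
          satisfied v i≤v with v ≟ i
          ... | yes refl = proj₂ stepped
          ... | no v≢i   = proj₁ (proj₂ (proj₂ found)) v (≤∧≢⇒< i≤v (v≢i ∘ sym ∘ toℕ-injective))

        complete′ : Complete (toℕ i) A′
        complete′ S sat
            with q , m , cells , zeros , size ← complete S sat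
            with q″ , step , state″ ← δ-complete sat (q p) (q i)
                   (proj₂ (cells p (m≤n⇒m≤1+n p<i))) (proj₂ (cells i ≤-refl))
            with a , A′q″p , a≤ ← ≤⁺-finite (subst (A′ q″ p ≤⁺_)
                   (cong₂ _+∞_ (proj₁ (cells p (m≤n⇒m≤1+n p<i))) (proj₁ (cells i ≤-refl)))
                   (lower (q p) (q i) step)) =
          q₋ , m₋ , cells′ , zeros′ , ≤-trans (sum-transfer-≤ p≢i
            (λ v v≢p v≢i → override₂-other m p≢i v≢p v≢i)
            (subst (_≤ m p + m i)
              (sym (trans (cong₂ _+_ (override₂-fst m p≢i) (override₂-snd m p≢i)) (+-identityʳ a))) a≤)) size
          where
          q₋ = override₂ {p = p} {i} q″ (q i) q
          m₋ = override₂ {p = p} {i} a 0 m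
          cells′ : ∀ v → toℕ v < toℕ i → A′ (q₋ v) v ≡ [ m₋ v ] × HasState (toℕ i) S v (q₋ v)
          cells′ v v<i with position v
          ... | parent refl rewrite override₂-fst {x = q″} {q i} q p≢i | override₂-fst {x = a} {0} m p≢i =
                A′q″p , state″
          ... | merged refl = contradiction v<i (<-irrefl refl)
          ... | other v≢p v≢i
                rewrite override₂-other {x = q″} {q i} q p≢i v≢p v≢i
                      | override₂-other {x = a} {0} m p≢i v≢p v≢i =
                trans (unchanged (q v) v v≢p) (proj₁ (cells v (m≤n⇒m≤1+n v<i))) ,
                HasState-other v<i v≢p (q v) (proj₂ (cells v (m≤n⇒m≤1+n v<i)))
          zeros′ : ∀ v → toℕ i ≤ toℕ v → m₋ v ≡ 0
          zeros′ v i≤v with position v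
          ... | parent refl = contradiction i≤v (<⇒≱ p<i)
          ... | merged refl = override₂-snd m p≢i
          ... | other v≢p v≢i = trans (override₂-other m p≢i v≢p v≢i)
                  (zeros v (≤∧≢⇒< i≤v (v≢i ∘ sym ∘ toℕ-injective)))

  -- Reading off the optimum at the root

  module Root {root : Fin n} (root≡0 : toℕ root ≡ 0) where

    -- The root is the only vertex below the threshold 1, and it is not adjacent to itself.
    count-root : ∀ S → count 0 S root ≡ count 1 S root
    count-root S = sum-cong-≗ agree
      where
      agree : ∀ u → link S root u ≡ from 1 (toℕ u) (link S root u)
      agree u with toℕ u in u≡
      ... | zero  = link-¬adj S (irrefl (toℕ-injective (trans root≡0 (sym u≡))))
      ... | suc _ = refl

    only-root : ∀ {v} → toℕ v < 1 → v ≡ root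
    only-root v<1 = toℕ-injective (trans (n<1⇒n≡0 v<1) (sym root≡0))

    accepting-satisfied : ∀ {S} j → HasState 1 S root (accepting j) → Satisfied S root
    accepting-satisfied zero S[r] ¬S[r] = contradiction (trans (sym S[r]) ¬S[r]) λ ()
    accepting-satisfied {S} (suc j) (_ , c) _ =
      subst (λ c → 1 ≤ c × c ≤ k) (sym (trans (count-root S) c)) (s≤s z≤n , toℕ<n j)

    satisfied-accepting : ∀ {S} q → Satisfied S root → HasState 1 S root q → ∃[ j ] q ≡ accepting j
    satisfied-accepting In               sat _          = zero , refl
    satisfied-accepting {S} (Out zero)   sat (¬S[r] , c) =
      contradiction (subst (1 ≤_) (trans (count-root S) c) (proj₁ (sat ¬S[r]))) λ ()
    satisfied-accepting (Out (suc j))    sat _          = suc j , refl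

    module _ {A : State → Fin n → ℕ∞} (inv : Invariant 1 A) where
      open Invariant inv

      -- Only the root remains, so a single finite entry there is a complete selection; the constant
      -- vector of states suffices.
      root-sound : ∀ {q a} → A q root ≡ [ a ] →
                   ∃[ S ] HasState 1 S root q × (∀ v → 1 ≤ toℕ v → Satisfied S v) × ∣ S ∣ ≡ a
      root-sound {q} {a} Aq≡a = conclude (sound (const q) m cells zeros)
        where
        m : Vector ℕ n
        m = updateAt (const 0) root (const a)
        cells : ∀ v → toℕ v < 1 → A q v ≡ [ m v ]
        cells v v<1 with refl ← only-root v<1 = trans Aq≡a (cong [_] (sym (updateAt-updates root _)))
        zeros : ∀ v → 1 ≤ toℕ v → m v ≡ 0
        zeros v 1≤v = updateAt-minimal v root _ λ { refl → contradiction root≡0 (>⇒≢ 1≤v) }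
        sum-m : sum m ≡ a
        sum-m = trans (sum-differ-at {g = const 0} root (λ u → updateAt-minimal u root _) (updateAt-updates root _))
                      (cong (_+ a) (sum-replicate-zero n))
        conclude : (∃[ S ] (∀ v → toℕ v < 1 → HasState 1 S v q)
                         × (∀ v → 1 ≤ toℕ v → Satisfied S v) × ∣ S ∣ ≡ sum m) →
                   ∃[ S ] HasState 1 S root q × (∀ v → 1 ≤ toℕ v → Satisfied S v) × ∣ S ∣ ≡ a
        conclude (S , states , satisfied , size) =
          S , states root (s≤s (≤-reflexive root≡0)) , satisfied , trans size sum-m

      root-bounded : ∀ {q a} → A q root ≡ [ a ] → a ≤ n
      root-bounded Aq≡a with S , _ , _ , size ← root-sound Aq≡a = subst (_≤ n) size (∣p∣≤n S)

      -- Completeness for `⊤` shows that `r` is finite, hence attained by an accepting entry, which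
      -- `root-sound` turns into a dominating set. Completeness for an arbitrary dominating set
      -- gives minimality.
      minimum-correct : ∀ {r} → (∀ j → r ≤⁺ A (accepting j) root) →
                        r ≡ ⊤⁺ ⊎ (∃[ j ] r ≡ A (accepting j) root) →
                        ∃[ m ] r ≡ [ m ] × Isγ₁ₖ k T m
      minimum-correct {r} lower attained = conclude attained (proj₂ (optimal ⊤ ⊤-satisfied))
        where
        optimal : ∀ S → (∀ v → Satisfied S v) → ∃[ a ] r ≡ [ a ] × a ≤ ∣ S ∣
        optimal S sat
          with q , m , cells , _ , size ← complete S sat
          with Aq , state ← cells root (s≤s (≤-reflexive root≡0))
          with j , q≡ ← satisfied-accepting (q root) (sat root) state
          with a , r≡a , a≤ ← ≤⁺-finite (subst (r ≤⁺_) (trans (cong (λ q → A q root) (sym q≡)) Aq) (lower j)) =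
          a , r≡a , ≤-trans a≤ (≤-trans
            (subst (m root ≤_) (sym (sum-extract m root)) (m≤m+n _ _)) size)

        conclude : r ≡ ⊤⁺ ⊎ (∃[ j ] r ≡ A (accepting j) root) →
                   ∀ {a} → r ≡ [ a ] × a ≤ ∣ ⊤ {n} ∣ → ∃[ m ] r ≡ [ m ] × Isγ₁ₖ k T m
        conclude (inj₁ r≡⊤⁺)     (r≡a , _) = contradiction (trans (sym r≡a) r≡⊤⁺) λ ()
        conclude (inj₂ (j , r≡)) {a} (r≡a , _)
          with S , state , satisfied , size ← root-sound (trans (sym r≡) r≡a) =
          a , r≡a , (S , satisfied⇒dominating everywhere , size) , minimal
          where
          everywhere : ∀ v → Satisfied S v
          everywhere v with 1 ≤? toℕ v
          ... | yes 1≤v = satisfied v 1≤v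
          ... | no 1≰v with refl ← only-root (≰⇒> 1≰v) = accepting-satisfied j state
          minimal : ∀ S → QuasiperfectDominating k T S → a ≤ ∣ S ∣
          minimal S qd with optimal S (dominating⇒satisfied qd)
          ... | _ , r≡b , b≤ with refl ← trans (sym r≡a) r≡b = b≤

-- The order on `ℕ∞`

<⁺⇒≤⁺ : ∀ {x y} → x <⁺ y → x ≤⁺ y
<⁺⇒≤⁺ Strict.[ x<y ]     = NonStrict.[ <⇒≤ x<y ]
<⁺⇒≤⁺ Strict.[ _ ]<⊤⁺    = _ ≤⊤⁺

≮⁺⇒≥⁺ : ∀ {x y} → ¬ (x <⁺ y) → y ≤⁺ x
≮⁺⇒≥⁺ {⊤⁺}    {y}     _   = y ≤⊤⁺
≮⁺⇒≥⁺ {[ x ]} {[ y ]} x≮y = NonStrict.[ ≮⇒≥ (x≮y ∘ Strict.[_]) ]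
≮⁺⇒≥⁺ {[ x ]} {⊤⁺}    x≮y with () ← x≮y Strict.[ x ]<⊤⁺

≤⁺-refl : ∀ {x} → x ≤⁺ x
≤⁺-refl = NonStrict.≤⁺-reflexive-≡ ≤-reflexive refl

-- Costs and derived commands

module Costs (s a : ℕ) where
  open Syntax s a

  -- An upper bound on the running time of loop-free commands only.
  cost : Cmd → ℕ
  cost skip                   = 1
  cost (_ ≔ e)                = 1 + exprCost e
  cost (_ [ e ]≔ e′)          = 1 + exprCost e + exprCost e′
  cost (c ⨾ c′)               = cost c + cost c′
  cost (if b then c else c′)  = testCost b + (cost c + cost c′)
  cost (while _ loop _)       = 0

  -- The list is unrolled when the program is built. The lists in use depend on `k` alone, so the
  -- resulting command has constant cost.
  each : {X : Set} → (X → Cmd) → List X → Cmd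
  each f = foldr (λ x c → f x ⨾ c) skip

  -- The target becomes the minimum of itself and `e x`; where there is no target, nothing happens.
  relax : {X : Set} → (X → Maybe (Fin s)) → (X → Expr) → X → Cmd
  relax target e x = maybe′ (λ y → if e x ⟨ lt ⟩ var y then y ≔ e x else skip) skip (target x)

-- Rules for total correctness with time bounds

module Hoare (s a n : ℕ) where
  open Semantics s a n
  open Costs s a

  record Run (c : Cmd) (σ : Store) (B : ℕ) (Post : Store → Set) : Set where
    constructor run
    field
      {final} : Store
      {time}  : ℕ
      exec    : ⟨ c , σ ⟩⇓⟨ final ⟩ time
      bound   : time ≤ B
      post    : Post final

  run-map : ∀ {c σ B P Q} → (∀ {τ} → P τ → Q τ) → Run c σ B P → Run c σ B Q
  run-map f (run e b p) = run e b (f p)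

  run-skip : ∀ {σ P} → P σ → Run skip σ 1 P
  run-skip = run skip ≤-refl

  run-assign : ∀ {σ x e v P} → σ ⊢ e ⇓ v → P (setScalar x v σ) → Run (x ≔ e) σ (cost (x ≔ e)) P
  run-assign ev = run (assign ev) ≤-refl

  run-assignCell : ∀ {σ b e e′ i v P} → σ ⊢ e ⇓ [ # i ] → σ ⊢ e′ ⇓ v → P (setCell b i v σ) →
                   Run (b [ e ]≔ e′) σ (cost (b [ e ]≔ e′)) P
  run-assignCell ev ev′ = run (assignCell ev ev′) ≤-refl

  run-seq : ∀ {c c′ σ B B′ P Q} → Run c σ B P → (∀ {τ} → P τ → Run c′ τ B′ Q) → Run (c ⨾ c′) σ (B + B′) Q
  run-seq (run e b p) next with run e′ b′ q ← next p = run (seq e e′) (+-mono-≤ b b′) q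

  -- The index of `Inv` is the number of iterations left, so one induction yields both termination
  -- and the time: `j` bodies and `j + 1` tests.
  run-while : ∀ {b c B} {Inv : ℕ → Store → Set} →
              (∀ {j σ} → Inv (suc j) σ → (σ ⊢ b ⇓ᵗ true) × Run c σ B (Inv j)) →
              (∀ {σ} → Inv 0 σ → σ ⊢ b ⇓ᵗ false) →
              ∀ j {σ} → Inv j σ → Run (while b loop c) σ (testCost b + j * (testCost b + B)) (Inv 0)
  run-while step stop zero    i = run (while-false (stop i)) (m≤m+n _ _) i
  run-while {b} {c} {B} {Inv} step stop (suc j) i with ev , run e t≤ i′ ← step {j} i
    with run e′ t′≤ i″ ← run-while {Inv = Inv} step stop j i′ =
    run (while-true ev e e′) (≤-trans (+-mono-≤ (+-monoʳ-≤ (testCost b) t≤) t′≤) (≤-reflexive regroup)) i″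
    where
    T = testCost b
    regroup : T + B + (T + j * (T + B)) ≡ T + (T + B + j * (T + B))
    regroup = trans (sym (+-assoc (T + B) T _))
      (trans (cong (_+ j * (T + B)) (+-comm (T + B) T)) (+-assoc T (T + B) _))

  -- Commands may run in any order as long as none of them destroys what another achieved.
  run-each : {X : Set} {f : X → Cmd} {Inv : Store → Set} {P : X → Store → Set} →
             (∀ x {σ} → Inv σ → Run (f x) σ (cost (f x)) (λ τ → Inv τ × P x τ × (∀ y → P y σ → P y τ))) →
             ∀ xs {σ} → Inv σ → Run (each f xs) σ (cost (each f xs)) (λ τ → Inv τ × (∀ {x} → x ∈ xs → P x τ))
  run-each {X} {f} {Inv} {P} step xs i = run-map (λ (i , p , _) → i , p) (go xs i)
    where
    go : ∀ xs {σ} → Inv σ → Run (each f xs) σ (cost (each f xs))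
           (λ τ → Inv τ × (∀ {x} → x ∈ xs → P x τ) × (∀ y → P y σ → P y τ))
    go []       i = run-skip (i , (λ ()) , λ _ → id)
    go (x ∷ xs) i = run-seq (step x i) λ (i , p , keep) →
      run-map (λ (i , ps , keep′) → i ,
        (λ { (here refl) → keep′ _ p ; (there x∈) → ps x∈ }) , λ y → keep′ y ∘ keep y) (go xs i)

  -- `Frame` fixes what the expressions read, and assignments to targets preserve it, so each `e x`
  -- keeps its value throughout. Targets only decrease, so an upper bound once reached persists, and
  -- each scalar is either untouched or equal to one of the values aimed at it.
  run-relaxAll : {X : Set} (target : X → Maybe (Fin s)) (e : X → Expr) (value : X → ℕ∞)
    (Frame : Store → Set) {σ : Store} →
    (∀ x {y w τ} → target x ≡ just y → Frame τ → Frame (setScalar y w τ)) →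
    (∀ x {τ} → Frame τ → τ ⊢ e x ⇓ value x) →
    (∀ x → Operand (value x)) →
    (∀ x {y} → target x ≡ just y → Operand (scalar σ y)) →
    ∀ xs → Frame σ →
    Run (each (relax target e) xs) σ (cost (each (relax target e) xs)) (λ τ →
      (Frame τ × (∀ y → scalar τ y ≡ scalar σ y ⊎ (∃[ x ] target x ≡ just y × scalar τ y ≡ value x)))
      × (∀ {x} → x ∈ xs → ∀ {y} → target x ≡ just y → scalar τ y ≤⁺ value x))
  run-relaxAll {X} target e value Frame {σ} stable eval small small₀ xs frame =
    run-each step xs (frame , λ _ → inj₁ refl)
    where
    Inv : Store → Set
    Inv τ = Frame τ × (∀ y → scalar τ y ≡ scalar σ y ⊎ (∃[ x ] target x ≡ just y × scalar τ y ≡ value x))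

    P : X → Store → Set
    P x τ = ∀ {y} → target x ≡ just y → scalar τ y ≤⁺ value x

    Step : X → Store → Store → Set
    Step x τ τ′ = Inv τ′ × P x τ′ × (∀ z → P z τ → P z τ′)

    Relax : Expr → Maybe (Fin s) → Cmd
    Relax e = maybe′ (λ y → if e ⟨ lt ⟩ var y then y ≔ e else skip) skip

    step : ∀ x {τ} → Inv τ → Run (relax target e x) τ (cost (relax target e x)) (Step x τ)
    step x {τ} (fr , origin) = go (target x) refl
      where
      go : ∀ t → target x ≡ t → Run (Relax (e x) t) τ (cost (Relax (e x) t)) (Step x τ)
      go nothing tx = run-skip ((fr , origin) , (λ tx′ → ⊥-just (trans (sym tx) tx′)) , λ _ p → p)
        where
        ⊥-just : ∀ {y} {A : Set} → nothing ≡ just y → A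
        ⊥-just ()
      go (just y) tx = branch (<⁺-dec _<?_ (value x) (scalar τ y))
       where
        -- The comparison is legal because `origin` traces the current content back to the initial
        -- one or to some `value`.
        current-small : Operand (scalar τ y)
        current-small with origin y
        ... | inj₁ eq₀            = subst Operand (sym eq₀) (small₀ x tx)
        ... | inj₂ (z , _ , eq₁) = subst Operand (sym eq₁) (small z)

        test : ∀ {b} → Reflects (value x <⁺ scalar τ y) b → τ ⊢ e x ⟨ lt ⟩ var y ⇓ᵗ b
        test = compare (eval x fr) var (small x) current-small

        τ′ = setScalar y (value x) τ

        same : scalar τ′ y ≡ value x
        same = updateAt-updates y (scalar τ)

        branch : Dec (value x <⁺ scalar τ y) →
                 Run (if e x ⟨ lt ⟩ var y then y ≔ e x else skip) τ _ (Step x τ)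
        branch (yes v<y) = run (if-true (test (ofʸ v<y)) (assign (eval x fr)))
          (+-monoʳ-≤ (testCost (e x ⟨ lt ⟩ var y)) (m≤m+n _ 1))
          ((stable x tx fr , origin′) , achieved , keep)
          where
          origin′ : ∀ z → scalar τ′ z ≡ scalar σ z ⊎ (∃[ x ] target x ≡ just z × scalar τ′ z ≡ value x)
          origin′ z with z ≟ y
          ... | yes refl = inj₂ (x , tx , same)
          ... | no z≢y rewrite updateAt-minimal z y {f = λ _ → value x} (scalar τ) z≢y = origin z
          achieved : P x τ′
          achieved tx′ with refl ← trans (sym tx) tx′ = subst (_≤⁺ value x) (sym same) ≤⁺-refl
          keep : ∀ z → P z τ → P z τ′
          keep z p {y′} tz with y′ ≟ y
          ... | yes refl = subst (_≤⁺ value z) (sym same) (≤⁺-trans ≤-trans (<⁺⇒≤⁺ v<y) (p tz))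
          ... | no y′≢y rewrite updateAt-minimal y′ y {f = λ _ → value x} (scalar τ) y′≢y = p tz
        branch (no v≮y) = run (if-false (test (ofⁿ v≮y)) skip)
          (+-monoʳ-≤ (testCost (e x ⟨ lt ⟩ var y)) (m≤n+m 1 (1 + exprCost (e x))))
          ((fr , origin) , achieved , λ _ p → p)
          where
          achieved : P x τ
          achieved tx′ with refl ← trans (sym tx) tx′ = ≮⁺⇒≥⁺ v≮y

-- The program

module Algorithm (k : ℕ) where

  open Automaton k

  #states #scalars #arrays : ℕ
  #states  = 2 + k
  #scalars = 4 + #states
  #arrays  = 2 + #states

  open Syntax #scalars #arrays
  open Costs #scalars #arrays

  pattern size    = zero
  pattern result  = suc zero
  pattern current = suc (suc zero)
  pattern above   = suc (suc (suc zero))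
  pattern temp q  = suc (suc (suc (suc q)))

  pattern parentOf = zero
  pattern previous = suc zero
  pattern table q  = suc (suc q)

  states : List State
  states = allFin #states

  writeColumn : Expr → (State → Expr) → Cmd
  writeColumn ix e = each (λ q → table q [ ix ]≔ e q) states

  -- The language has no subtraction; the loop that counts back from n reads
  -- i ∸ 1 from the array previous filled here.
  prepareNext : Cmd
  prepareNext =
    -- `result` is scratch space for the old number, which is the predecessor of the new one.
    result ≔ var current ⨾
    current ≔ var current ⊕ lit [ 1 ] ⨾
    previous [ var current ]≔ var result ⨾
    writeColumn (var current) (lit ∘ start)

  mergeTarget : State × State → Maybe (Fin #scalars)
  mergeTarget (q , q′) = map (λ q″ → temp q″) (δ q q′)

  mergeValue : State × State → Expr
  mergeValue (q , q′) = (table q ! var above) ⊕ (table q′ ! var current)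

  -- The minima are collected in the scalars `temp q`, since the old column of the parent is read
  -- until the last pair of states has been treated.
  mergeCurrent : Cmd
  mergeCurrent =
    above ≔ (parentOf ! var current) ⨾
    each (λ q → temp q ≔ lit ⊤⁺) states ⨾
    each (relax mergeTarget mergeValue) (cartesianProduct states states) ⨾
    writeColumn (var above) (λ q → var (temp q)) ⨾
    current ≔ (previous ! var current)

  -- When this starts, `current` is 1, the number of the root.
  finish : Cmd
  finish =
    result ≔ lit ⊤⁺ ⨾
    each (relax (λ _ → just result) (λ j → table (accepting j) ! var current)) (allFin (suc k))

  unprepared unmerged : Test
  unprepared = var current ⟨ lt ⟩ var size
  unmerged   = lit [ 1 ] ⟨ lt ⟩ var current

  body : Cmd
  body =
    current ≔ lit [ 0 ] ⨾
    while unprepared loop prepareNext ⨾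
    while unmerged loop mergeCurrent ⨾
    finish

  program : Program
  program = record { scalars = 2 + #states ; arrays = 1 + #states ; body = body }

  -- The first summand pays for the last, failing test; the rest is the price of one iteration.
  loopCost : Test → Cmd → ℕ
  loopCost b c = testCost b + (testCost b + cost c)

  -- The 2 is the cost of the initial assignment. Costs that occur only once are absorbed into the
  -- factor of `n`, as `n` is at least 1.
  rate : ℕ
  rate = 2 + (loopCost unprepared prepareNext + (loopCost unmerged mergeCurrent + cost finish))

-- Correctness and running time of the program

module Correctness (k : ℕ) {n : ℕ} (T : Graph n) (Parent : Vector ℕ n) (isParentArray : IsParentArray T Parent) where

  open Automaton k
  open Algorithm k
  open Tables k T Parent isParentArray
  open IsParentArray isParentArray
  open Semantics #scalars #arrays n
  open Costs #scalars #arrays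
  open Hoare #scalars #arrays n

  tables : Store → State → Fin n → ℕ∞
  tables σ q = array σ (table q)

  small-finite : ∀ {v} → (∀ {x} → v ≡ [ x ] → x ≤ n) → Operand v
  small-finite {[ x ]} bound = All.just (bound refl)
  small-finite {⊤⁺}    _     = All.nothing

  run-writeColumn : ∀ ix e {v σ} {x : State → ℕ∞} →
    (∀ {τ} → scalar τ ≡ scalar σ → τ ⊢ ix ⇓ [ # v ]) →
    (∀ q {τ} → scalar τ ≡ scalar σ → τ ⊢ e q ⇓ x q) →
    Run (writeColumn ix e) σ (cost (writeColumn ix e)) (λ τ →
      scalar τ ≡ scalar σ
      × array τ parentOf ≡ array σ parentOf × array τ previous ≡ array σ previous
      × (∀ q u → u ≢ v → tables τ q u ≡ tables σ q u)
      × (∀ q → tables τ q v ≡ x q))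
  run-writeColumn ix e {v} {σ} {x} evalIx eval =
    run-map (λ ((s , pa , pr , rest) , written) → s , pa , pr , rest , λ q → written (∈-allFin q))
      (run-each step states (refl , refl , refl , λ _ _ _ → refl))
    where
    Inv : Store → Set
    Inv τ = scalar τ ≡ scalar σ
      × array τ parentOf ≡ array σ parentOf × array τ previous ≡ array σ previous
      × (∀ q u → u ≢ v → tables τ q u ≡ tables σ q u)

    P : State → Store → Set
    P q τ = tables τ q v ≡ x q

    step : ∀ q {τ} → Inv τ → Run (table q [ ix ]≔ e q) τ (cost (table q [ ix ]≔ e q))
                               (λ τ′ → Inv τ′ × P q τ′ × (∀ q′ → P q′ τ → P q′ τ′))
    step q {τ} (s , pa , pr , rest) = run-assignCell (evalIx s) (eval q s)
      ((s , pa , pr , λ q′ u u≢v → trans (elsewhere q′ u≢v) (rest q′ u u≢v)) , written , keep)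
      where
      τ′ = setCell (table q) v (x q) τ

      column : tables τ′ q ≡ updateAt (tables τ q) v (λ _ → x q)
      column = updateAt-updates q (tables τ)

      written : P q τ′
      written = trans (cong (λ f → f v) column) (updateAt-updates v (tables τ q))

      elsewhere : ∀ q′ {u} → u ≢ v → tables τ′ q′ u ≡ tables τ q′ u
      elsewhere q′ {u} u≢v with q′ ≟ q
      ... | yes refl = trans (cong (λ f → f u) column) (updateAt-minimal u v (tables τ q) u≢v)
      ... | no q′≢q  = cong (λ f → f u) (updateAt-minimal q′ q (tables τ) q′≢q)

      keep : ∀ q′ → P q′ τ → P q′ τ′
      keep q′ p with q′ ≟ q
      ... | yes refl = written
      ... | no q′≢q  = trans (cong (λ f → f v) (updateAt-minimal q′ q (tables τ) q′≢q)) p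

  -- The loop that prepares the columns

  record Prepared (t : ℕ) (σ : Store) : Set where
    field
      t≤n       : t ≤ n
      size≡     : scalar σ size ≡ [ n ]
      current≡  : scalar σ current ≡ [ t ]
      parents   : ∀ v → array σ parentOf v ≡ [ Parent v ]
      previous≡ : ∀ v → toℕ v < t → array σ previous v ≡ [ toℕ v ]
      table≡    : ∀ q v → toℕ v < t → tables σ q v ≡ start q

  var-≡ : ∀ {σ x v} → scalar σ x ≡ v → σ ⊢ var x ⇓ v
  var-≡ refl = var

  cell : ∀ {σ b e i v} → σ ⊢ e ⇓ [ # i ] → array σ b i ≡ v → σ ⊢ b ! e ⇓ v
  cell ev refl = _ ! ev

  <suc-split : ∀ {u v : Fin n} → toℕ u < suc (toℕ v) → u ≡ v ⊎ (u ≢ v × toℕ u < toℕ v)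
  <suc-split {u} {v} u≤v with u ≟ v
  ... | yes u≡v = inj₁ u≡v
  ... | no u≢v  = inj₂ (u≢v , ≤∧≢⇒< (s≤s⁻¹ u≤v) (u≢v ∘ toℕ-injective))

  prepare-step : ∀ v {σ} → Prepared (toℕ v) σ →
                 Run prepareNext σ (cost prepareNext) (Prepared (suc (toℕ v)))
  prepare-step v {σ} prep =
    run-seq (run-assign {P = _≡ σ₁} (var-≡ current≡) refl) λ { refl →
    run-seq (run-assign {P = _≡ σ₂} (add (var-≡ current≡) lit (All.just t≤n) (All.just (≤-trans (s≤s z≤n) (toℕ<n v)))) refl) λ { refl →
    run-seq (run-assignCell {i = v} {P = _≡ σ₃} (var-≡ (cong [_] (+-comm (toℕ v) 1))) var refl) λ { refl →
    run-map finished (run-writeColumn (var current) (lit ∘ start) {v = v}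
      (λ s → var-≡ (trans (cong (λ f → f current) s) (cong [_] (+-comm (toℕ v) 1)))) (λ _ _ → lit)) } } }
    where
    open Prepared prep
    σ₁ = setScalar result [ toℕ v ] σ
    σ₂ = setScalar current [ toℕ v + 1 ] σ₁
    σ₃ = setCell previous v [ toℕ v ] σ₂
    finished : ∀ {τ} →
      scalar τ ≡ scalar σ₃
      × array τ parentOf ≡ array σ₃ parentOf × array τ previous ≡ array σ₃ previous
      × (∀ q u → u ≢ v → tables τ q u ≡ tables σ₃ q u)
      × (∀ q → tables τ q v ≡ start q) → Prepared (suc (toℕ v)) τ
    finished {τ} (s , pa , pr , rest , written) = record
      { t≤n       = toℕ<n v
      ; size≡     = trans (cong (λ f → f size) s) size≡
      ; current≡  = trans (cong (λ f → f current) s) (cong [_] (+-comm (toℕ v) 1))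
      ; parents   = λ u → trans (cong (λ f → f u) pa) (parents u)
      ; previous≡ = previous′
      ; table≡    = table′
      }
      where
      previous′ : ∀ u → toℕ u < suc (toℕ v) → array τ previous u ≡ [ toℕ u ]
      previous′ u u≤v with <suc-split {u} {v} u≤v
      ... | inj₁ refl        = trans (cong (λ f → f u) pr) (updateAt-updates u _)
      ... | inj₂ (u≢v , u<v) = trans (cong (λ f → f u) pr)
              (trans (updateAt-minimal u v _ u≢v) (previous≡ u u<v))
      table′ : ∀ q u → toℕ u < suc (toℕ v) → tables τ q u ≡ start q
      table′ q u u≤v with <suc-split {u} {v} u≤v
      ... | inj₁ refl        = written q
      ... | inj₂ (u≢v , u<v) = trans (rest q u u≢v) (table≡ q u u<v)

  -- The loop counts upwards whereas `run-while` counts the iterations left; `j + t ≡ n` links the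
  -- two.
  Preparing : ℕ → Store → Set
  Preparing j σ = ∃[ t ] j + t ≡ n × Prepared t σ

  run-prepare : ∀ {σ} → Prepared 0 σ →
    Run (while unprepared loop prepareNext) σ
        (testCost unprepared + n * (testCost unprepared + cost prepareNext)) (Prepared n)
  run-prepare prep = run-map (λ { (_ , refl , prep) → prep })
    (run-while {Inv = Preparing} continue stop n (0 , +-identityʳ n , prep))
    where
    continue : ∀ {j σ} → Preparing (suc j) σ →
               (σ ⊢ unprepared ⇓ᵗ true) × Run prepareNext σ (cost prepareNext) (Preparing j)
    continue {j} {σ} (t , j+t≡n , prep) =
      compare (var-≡ current≡) (var-≡ size≡) (All.just t≤n) (All.just ≤-refl) (ofʸ Strict.[ t<n ]) ,
      run-map (λ prep → suc t , trans (+-suc j t) j+t≡n , subst (λ t → Prepared (suc t) _) v≡t prep)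
        (prepare-step v (subst (λ t → Prepared t σ) (sym v≡t) prep))
      where
      open Prepared prep
      t<n : t < n
      t<n = subst (suc t ≤_) j+t≡n (s≤s (m≤n+m t j))
      v = fromℕ< t<n
      v≡t = toℕ-fromℕ< t<n
    stop : ∀ {σ} → Preparing 0 σ → σ ⊢ unprepared ⇓ᵗ false
    stop (t , refl , prep) =
      compare (var-≡ current≡) (var-≡ size≡) (All.just ≤-refl) (All.just ≤-refl)
        (ofⁿ λ { Strict.[ t<t ] → <-irrefl refl t<t })
      where open Prepared prep

  -- The zero-based index `j` of the current vertex is also the number of merges left, so this
  -- serves directly as the invariant of `run-while`.
  record Merging (j : ℕ) (σ : Store) : Set where
    field
      j<n       : j < n
      current≡  : scalar σ current ≡ [ suc j ]
      parents   : ∀ v → array σ parentOf v ≡ [ Parent v ]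
      previous≡ : ∀ v → array σ previous v ≡ [ toℕ v ]
      invariant : Invariant (suc j) (tables σ)

  -- A single merge, and the merging loop

  module _ {i p : Fin n} (p-parent : p ParentOf i) {σ : Store} (merging : Merging (toℕ i) σ) where
    open Merging merging
    open Merge p-parent

    Located : Store → Set
    Located τ = array τ ≡ array σ × scalar τ current ≡ [ # i ] × scalar τ above ≡ [ # p ]

    -- `sum-bounded` speaks of pairs, so a finite entry at `p` is paired with the entry that `⊤`
    -- selects at `i`; `small-current` does the same with the roles exchanged.
    small-parent : ∀ q → Operand (tables σ q p)
    small-parent q with _ , m , cells , _ ← Invariant.complete invariant ⊤ ⊤-satisfied =
      small-finite λ eq₀ → m+n≤o⇒m≤o _ (sum-bounded invariant eq₀ (proj₁ (cells i ≤-refl)))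

    small-current : ∀ q → Operand (tables σ q i)
    small-current q with _ , m , cells , _ ← Invariant.complete invariant ⊤ ⊤-satisfied =
      small-finite λ eq₀ → m+n≤o⇒n≤o (m p)
        (sum-bounded invariant (proj₁ (cells p (m≤n⇒m≤1+n p<i))) eq₀)

    Minima : Store → Set
    Minima τ = Located τ
      × (∀ q″ → scalar τ (temp q″) ≡ ⊤⁺ ⊎
           (∃[ q ] ∃[ q′ ] δ q q′ ≡ just q″ × scalar τ (temp q″) ≡ tables σ q p +∞ tables σ q′ i))
      × (∀ q q′ {q″} → δ q q′ ≡ just q″ → scalar τ (temp q″) ≤⁺ tables σ q p +∞ tables σ q′ i)

    run-clear : ∀ {τ} → Located τ →
      Run (each (λ q → temp q ≔ lit ⊤⁺) states) τ (cost (each (λ q → temp q ≔ lit ⊤⁺) states))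
          (λ τ → Located τ × (∀ q → scalar τ (temp q) ≡ ⊤⁺))
    run-clear located = run-map (λ (l , cleared) → l , λ q → cleared (∈-allFin q))
      (run-each step states located)
      where
      P : State → Store → Set
      P q τ = scalar τ (temp q) ≡ ⊤⁺
      step : ∀ q {τ} → Located τ → Run (temp q ≔ lit ⊤⁺) τ 2
                                     (λ τ′ → Located τ′ × P q τ′ × (∀ q′ → P q′ τ → P q′ τ′))
      step q {τ} located = run-assign lit (located , updateAt-updates (temp q) (scalar τ) , keep)
        where
        keep : ∀ q′ → P q′ τ → P q′ (setScalar (temp q) ⊤⁺ τ)
        keep q′ cleared with q′ ≟ q
        ... | yes refl = updateAt-updates (temp q) (scalar τ)
        ... | no q′≢q  = trans (updateAt-minimal (temp q′) (temp q) (scalar τ)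
                                  (λ { refl → q′≢q refl })) cleared

    target-temp : ∀ x {y} → mergeTarget x ≡ just y → ∃[ q″ ] δ (proj₁ x) (proj₂ x) ≡ just q″ × y ≡ temp q″
    target-temp (q , q′) eqn with δ q q′
    target-temp (q , q′) refl | just q″ = q″ , refl , refl

    run-minima : ∀ {τ} → Located τ × (∀ q → scalar τ (temp q) ≡ ⊤⁺) →
      Run (each (relax mergeTarget mergeValue) (cartesianProduct states states)) τ
          (cost (each (relax mergeTarget mergeValue) (cartesianProduct states states))) Minima
    run-minima {τ} (located , cleared) = run-map minima
      (run-relaxAll mergeTarget mergeValue value Located stable eval small small₀ _ located)
      where
      value : State × State → ℕ∞
      value (q , q′) = tables σ q p +∞ tables σ q′ i

      stable : ∀ x {y w τ} → mergeTarget x ≡ just y → Located τ → Located (setScalar y w τ)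
      -- Every target is some `temp q″`, distinct from `current` and `above`.
      stable x tx located with _ , _ , refl ← target-temp x tx = located

      eval : ∀ x {τ} → Located τ → τ ⊢ mergeValue x ⇓ value x
      eval (q , q′) (refl , current≡ , above≡) =
        add (_ ! var-≡ above≡) (_ ! var-≡ current≡) (small-parent q) (small-current q′)

      small : ∀ x → Operand (value x)
      small (q , q′) = small-finite λ sum≡ → bound (+∞-finite sum≡)
        where
        bound : ∀ {s} → ∃[ a ] ∃[ b ] tables σ q p ≡ [ a ] × tables σ q′ i ≡ [ b ] × a + b ≡ s → s ≤ n
        bound (_ , _ , Aq , Aq′ , refl) = sum-bounded invariant Aq Aq′

      small₀ : ∀ x {y} → mergeTarget x ≡ just y → Operand (scalar τ y)
      small₀ x tx with q″ , _ , refl ← target-temp x tx rewrite cleared q″ = All.nothing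

      minima : ∀ {τ′} →
        (Located τ′ × (∀ y → scalar τ′ y ≡ scalar τ y ⊎
          (∃[ x ] mergeTarget x ≡ just y × scalar τ′ y ≡ value x))) ×
        (∀ {x} → x ∈ cartesianProduct states states → ∀ {y} → mergeTarget x ≡ just y →
           scalar τ′ y ≤⁺ value x) → Minima τ′
      minima {τ′} ((located , origin) , lower) = located , attained ,
        λ q q′ step → lower (∈-cartesianProduct⁺ (∈-allFin q) (∈-allFin q′)) (cong (map (λ q″ → temp q″)) step)
        where
        attained : ∀ q″ → scalar τ′ (temp q″) ≡ ⊤⁺ ⊎
          (∃[ q ] ∃[ q′ ] δ q q′ ≡ just q″ × scalar τ′ (temp q″) ≡ value (q , q′))
        attained q″ with origin (temp q″)
        ... | inj₁ initial = inj₁ (trans initial (cleared q″))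
        ... | inj₂ (x , tx , v≡) with _ , step , refl ← target-temp x tx =
          inj₂ (proj₁ x , proj₂ x , step , v≡)

    module _ {j : ℕ} (i≡1+j : toℕ i ≡ suc j) where

      run-commit : ∀ {τ} → Minima τ →
        Run (writeColumn (var above) (λ q → var (temp q)) ⨾ current ≔ (previous ! var current)) τ
            (cost (writeColumn (var above) (λ q → var (temp q))) + 3) (Merging j)
      run-commit {τ} ((arr , current-i , above-p) , attained , lower) =
        run-seq (run-writeColumn (var above) (λ q → var (temp q)) {v = p}
          (λ s → var-≡ (trans (cong (λ f → f above) s) above-p))
          (λ q s → var-≡ (cong (λ f → f (temp q)) s)))
        λ {τ₁} (s , pa , pr , rest , written) →
        -- `previous` holds `toℕ i` at `i`, which is `# i` minus one and hence `suc j`, the number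
        -- of the next vertex to treat.
        run-assign (cell (var-≡ (trans (cong (λ f → f current) s) current-i))
            (trans (cong (λ f → f i) (trans pr (cong (λ f → f previous) arr))) (previous≡ i)))
          (record
            { j<n       = <-trans (subst (j <_) (sym i≡1+j) ≤-refl) (toℕ<n i)
            ; current≡  = cong [_] i≡1+j
            ; parents   = λ v → trans (cong (λ f → f v) (trans pa (cong (λ f → f parentOf) arr))) (parents v)
            ; previous≡ = λ v → trans (cong (λ f → f v) (trans pr (cong (λ f → f previous) arr))) (previous≡ v)
            ; invariant = subst (λ t → Invariant t (tables τ₁)) i≡1+j (invariant-merge invariant (record
                { unchanged = λ q v v≢p → trans (rest q v v≢p) (cong (λ f → f (table q) v) arr)
                ; lower     = λ q q′ step → subst (_≤⁺ _) (sym (written _)) (lower q q′ step)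
                ; attained  = λ q″ → subst (λ x → x ≡ ⊤⁺ ⊎ (∃[ q ] ∃[ q′ ] δ q q′ ≡ just q″ × x ≡ _))
                                       (sym (written q″)) (attained q″)
                }))
            })

      merge-step : Run mergeCurrent σ (cost mergeCurrent) (Merging j)
      merge-step = run-seq
        (run-assign {P = Located} (cell (var-≡ current≡) (parents i)) (refl , current≡ , cong [_] (proj₂ p-parent)))
        λ located → run-seq (run-clear located) λ cleared → run-seq (run-minima cleared) run-commit

  run-merge : ∀ j {σ} → Merging j σ →
    Run (while unmerged loop mergeCurrent) σ
        (testCost unmerged + j * (testCost unmerged + cost mergeCurrent)) (Merging 0)
  run-merge = run-while {Inv = Merging} continue stop
    where
    continue : ∀ {j σ} → Merging (suc j) σ →
               (σ ⊢ unmerged ⇓ᵗ true) × Run mergeCurrent σ (cost mergeCurrent) (Merging j)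
    continue {j} {σ} merging =
      compare lit (var-≡ current≡) (All.just (≤-trans (s≤s z≤n) j<n)) (All.just j<n) (ofʸ Strict.[ s≤s (s≤s z≤n) ]) ,
      merge-step (proj₂ (hasParent i i≢root)) (subst (λ t → Merging t σ) (sym i≡) merging) i≡
      where
      open Merging merging
      i  = fromℕ< j<n
      i≡ = toℕ-fromℕ< j<n
      i≢root : # i ≢ 1
      i≢root #i≡1 = contradiction (trans (sym i≡) (suc-injective #i≡1)) λ ()
    stop : ∀ {σ} → Merging 0 σ → σ ⊢ unmerged ⇓ᵗ false
    stop merging = compare lit (var-≡ current≡) (All.just j<n) (All.just j<n) (ofⁿ λ { Strict.[ s≤s () ] })
      where open Merging merging

  -- The final minimum and the total running time

  Correct : Store → Set
  Correct τ = ∃[ m ] scalar τ result ≡ [ m ] × Isγ₁ₖ k T m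

  run-finish : ∀ {σ} → Merging 0 σ → Run finish σ (cost finish) Correct
  run-finish {σ} merging = run-seq (run-assign {P = _≡ setScalar result ⊤⁺ σ} lit refl) λ { refl →
    run-map correct (run-relaxAll (λ _ → just result) e value Frame
      (λ { _ refl frame → frame }) eval small (λ { _ refl → All.nothing }) (allFin (suc k)) (refl , current≡)) }
    where
    open Merging merging
    root = fromℕ< j<n
    open Root (toℕ-fromℕ< j<n)

    e = λ j → table (accepting j) ! var current

    value : Fin (suc k) → ℕ∞
    value j = tables σ (accepting j) root

    Frame : Store → Set
    Frame τ = array τ ≡ array σ × scalar τ current ≡ [ 1 ]

    eval : ∀ j {τ} → Frame τ → τ ⊢ e j ⇓ value j
    eval j (refl , current≡) = _ ! var-≡ (trans current≡ (cong (λ t → [ suc t ]) (sym (toℕ-fromℕ< j<n))))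

    small : ∀ j → Operand (value j)
    small j = small-finite (root-bounded invariant)

    correct : ∀ {τ} →
      (Frame τ × (∀ y → scalar τ y ≡ scalar (setScalar result ⊤⁺ σ) y ⊎
        (∃[ j ] just result ≡ just y × scalar τ y ≡ value j))) ×
      (∀ {j} → j ∈ allFin (suc k) → ∀ {y} → just result ≡ just y → scalar τ y ≤⁺ value j) →
      Correct τ
    correct {τ} ((_ , origin) , lower) = minimum-correct invariant (λ j → lower (∈-allFin j) refl) (attained (origin result))
      where
      attained : scalar τ result ≡ ⊤⁺ ⊎ (∃[ j ] just result ≡ just result × scalar τ result ≡ value j) →
                 scalar τ result ≡ ⊤⁺ ⊎ (∃[ j ] scalar τ result ≡ value j)
      attained (inj₁ initial)      = inj₁ initial
      attained (inj₂ (j , _ , v≡)) = inj₂ (j , v≡)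

  run-body : ∀ {σ} → 1 ≤ n → scalar σ size ≡ [ n ] → (∀ v → array σ parentOf v ≡ [ Parent v ]) →
             Run body σ (rate * n) Correct
  run-body {σ} 1≤n sized loaded = run-weaken (affine-≤ 2 (testCost unprepared) _ (testCost unmerged) _ (cost finish) 1≤n)
    (run-seq (run-assign {P = Prepared 0} lit initial) λ prep →
    run-seq (run-prepare prep) λ prep →
    -- All `n` columns are prepared, but the root is not merged, which leaves `pred n` iterations.
    run-seq (run-merge (pred n) (merging prep)) run-finish)
    where
    initial : Prepared 0 (setScalar current [ 0 ] σ)
    initial = record
      { t≤n = z≤n ; size≡ = sized ; current≡ = refl ; parents = loaded
      ; previous≡ = λ _ () ; table≡ = λ _ _ () }

    1+pred≡n : suc (pred n) ≡ n
    1+pred≡n = suc-pred n ⦃ >-nonZero 1≤n ⦄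

    merging : ∀ {τ} → Prepared n τ → Merging (pred n) τ
    merging prep = record
      { j<n       = ≤-reflexive 1+pred≡n
      ; current≡  = trans current≡ (cong [_] (sym 1+pred≡n))
      ; parents   = parents
      ; previous≡ = λ v → previous≡ v (toℕ<n v)
      ; invariant = subst (λ t → Invariant t _) (sym 1+pred≡n) (invariant-start λ q v → table≡ q v (toℕ<n v))
      }
      where open Prepared prep

    run-weaken : ∀ {c B B′ P} → B ≤ B′ → Run c σ B P → Run c σ B′ P
    run-weaken B≤B′ (run exec bound post) = run exec (≤-trans bound B≤B′) post

    affine-≤ : ∀ a b₁ c₁ b₂ c₂ d {m} → 1 ≤ m →
      a + (b₁ + m * c₁ + (b₂ + pred m * c₂ + d)) ≤ (a + (b₁ + c₁ + (b₂ + c₂ + d))) * m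
    affine-≤ a b₁ c₁ b₂ c₂ d {suc m} _ = ≤-trans (m≤m+n _ rest) (≤-reflexive (identity a b₁ c₁ b₂ c₂ d m))
      where
      -- The exact slack: each one-time cost is counted `m` times too often, and the second loop is
      -- charged one iteration too many.
      rest = (a + b₁ + b₂ + d) * m + c₂
      identity : ∀ a b₁ c₁ b₂ c₂ d m →
        a + (b₁ + suc m * c₁ + (b₂ + m * c₂ + d)) + ((a + b₁ + b₂ + d) * m + c₂)
        ≡ (a + (b₁ + c₁ + (b₂ + c₂ + d))) * suc m
      identity = solve-∀

theorem5 : ∀ (k : ℕ) → 1 ≤ k →
    ∃[ P ] ∃[ c ]
    (∀ (n : ℕ) (T : Graph n) (Parent : Vector ℕ n) →
    IsTree T → IsParentArray T Parent →
    Execution.OutputsWithin P n (c * n) Parent (Isγ₁ₖ k T))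
theorem5 k _ = program , rate , λ n T Parent isTree isParentArray σ initial →
  let open Execution program n
      run exec bound (m , result≡m , correct) = Correctness.run-body k T Parent isParentArray {σ}
        (>-nonZero⁻¹ n ⦃ IsTree.nonEmpty isTree ⦄) (Initial.size initial) (Initial.loaded initial)
  in _ , _ , m , exec , bound , result≡m , correct
  where
  open Algorithm k
  open Hoare using (run)
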